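{- For all integers $k\ge 2$, $\ell\ge 3$ and $r\ge 2$, \[ R(P_\ell^{(k)};r)\le (k-1)\ell r . \]
   Context: A $k$-uniform hypergraph ($k$-graph) is a pair (vertex set, set of $k$-element subsets called edges). For integers $k\ge 2$ and $\ell\ge 0$, the loose path $P_\ell^{(k)}$ is the $k$-graph with vertex set $\{v_1,\dots,v_{(k-1)\ell+1}\}$ and edges $e_i=\{v_{(i-1)(k-1)+q}:1\le q\le k\}$, $i=1,\dots,\ell$; so consecutive edges share exactly one vertex and non-consecutive edges are disjoint ($P_0^{(k)}$ is a single vertex, $P_1^{(k)}$ a single edge, and $P_\ell^{(2)}$ is the graph path with $\ell$ edges). $K_n^{(k)}$ denotes the complete $k$-graph on $n$ vertices. For a $k$-graph $H$ and integer $r\ge 2$, the multicolor Ramsey number $R(H;r)$ is the minimum $n$ such that every coloring of the edges of $K_n^{(k)}$ with $r$ colors contains a monochromatic copy of $H$. -}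

module Defs where

open import Data.Bool.Base using (true; false)
open import Data.Fin.Base using (Fin; zero; suc; toℕ; fromℕ<)
open import Data.Fin.Properties
  using (toℕ<n; toℕ-injective; suc-injective; fromℕ<-injective)
open import Data.Fin.Subset using (Subset; ∣_∣; _∈_; _∉_; ⁅_⁆; _∪_; ⊤; ⊥)
open import Data.Fin.Subset.Properties
  using (∉⊥; ∣⊥∣≡0; ∣⊤∣≡n; ∪-identityˡ; x∈p∪q⁻; x∈p∪q⁺; x∈⁅x⁆; x∈⁅y⁆⇒x≡y)
open import Data.Nat.Base using (ℕ; zero; suc; _+_; _*_; _∸_; _≤_; _<_; z≤n; s≤s)
import Data.Nat.Properties as ℕ
open import Data.Product.Base using (Σ-syntax; ∃-syntax; _×_; _,_)
open import Data.Sum.Base using (inj₁; inj₂)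
open import Data.Vec.Base using ([]; _∷_; here; there)
open import Function.Base using (_∘_)
open import Function.Bundles using (_↣_; mk↣; module Injection)
open import Function.Definitions using (Injective)
open import Level using (0ℓ)
open import Relation.Binary.PropositionalEquality
  using (_≡_; trans; cong)
open import Relation.Nullary.Negation using (contradiction)
open import Relation.Unary using (Pred)

private
  variable
    k m n r : ℕ

image : (Fin m → Fin n) → Subset m → Subset n
image f []          = ⊥
image f (true  ∷ s) = ⁅ f zero ⁆ ∪ image (f ∘ suc) s
image f (false ∷ s) = image (f ∘ suc) s

∈-image⁺ : (f : Fin m → Fin n) {s : Subset m} {x : Fin m} →
           x ∈ s → f x ∈ image f s
∈-image⁺ f {true  ∷ s} here      = x∈p∪q⁺ (inj₁ (x∈⁅x⁆ (f zero)))
∈-image⁺ f {true  ∷ s} (there h) = x∈p∪q⁺ (inj₂ (∈-image⁺ (f ∘ suc) h))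
∈-image⁺ f {false ∷ s} (there h) = ∈-image⁺ (f ∘ suc) h

∈-image⁻ : (f : Fin m → Fin n) (s : Subset m) {y : Fin n} →
           y ∈ image f s → ∃[ x ] (x ∈ s × y ≡ f x)
∈-image⁻ f []          h = contradiction h ∉⊥
∈-image⁻ f (true  ∷ s) h with x∈p∪q⁻ ⁅ f zero ⁆ (image (f ∘ suc) s) h
... | inj₁ h₀ = zero , here , x∈⁅y⁆⇒x≡y (f zero) h₀
... | inj₂ h₁ with ∈-image⁻ (f ∘ suc) s h₁
...   | x , x∈s , y≡fx = suc x , there x∈s , y≡fx
∈-image⁻ f (false ∷ s) h with ∈-image⁻ (f ∘ suc) s h
... | x , x∈s , y≡fx = suc x , there x∈s , y≡fx

∣⁅x⁆∪p∣≡1+∣p∣ : (x : Fin n) (p : Subset n) → x ∉ p → ∣ ⁅ x ⁆ ∪ p ∣ ≡ suc ∣ p ∣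
∣⁅x⁆∪p∣≡1+∣p∣ zero    (true  ∷ p) x∉p = contradiction here x∉p
∣⁅x⁆∪p∣≡1+∣p∣ zero    (false ∷ p) x∉p = cong (suc ∘ ∣_∣) (∪-identityˡ p)
∣⁅x⁆∪p∣≡1+∣p∣ (suc x) (true  ∷ p) x∉p = cong suc (∣⁅x⁆∪p∣≡1+∣p∣ x p (x∉p ∘ there))
∣⁅x⁆∪p∣≡1+∣p∣ (suc x) (false ∷ p) x∉p = ∣⁅x⁆∪p∣≡1+∣p∣ x p (x∉p ∘ there)

∣image∣ : (f : Fin m → Fin n) → Injective _≡_ _≡_ f →
          (s : Subset m) → ∣ image f s ∣ ≡ ∣ s ∣
∣image∣ {n = n} f inj []    = ∣⊥∣≡0 n
∣image∣ f inj (false ∷ s)   = ∣image∣ (f ∘ suc) (suc-injective ∘ inj) s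
∣image∣ f inj (true  ∷ s)   =
  trans (∣⁅x⁆∪p∣≡1+∣p∣ (f zero) (image (f ∘ suc) s) f0∉)
        (cong suc (∣image∣ (f ∘ suc) (suc-injective ∘ inj) s))
  where
  f0∉ : f zero ∉ image (f ∘ suc) s
  f0∉ h with ∈-image⁻ (f ∘ suc) s h
  ... | x , _ , eq with () ← inj eq

KSubset : ℕ → ℕ → Set
KSubset k n = Σ[ s ∈ Subset n ] ∣ s ∣ ≡ k

mapKSubset : Fin m ↣ Fin n → KSubset k m → KSubset k n
mapKSubset φ (s , ∣s∣≡k) =
  image (Injection.to φ) s , trans (∣image∣ (Injection.to φ) (Injection.injective φ) s) ∣s∣≡k

record Hypergraph (k : ℕ) : Set₁ where
  field
    order : ℕ
    Edge  : Pred (KSubset k order) 0ℓ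

open Hypergraph public

-- Vertices and edges are numbered from 0: the vertex v_j is j − 1 and the
-- edge e_i is i − 1, and the q-th vertex of an edge is q − 1.

pathVertex< : ∀ k ℓ (i : Fin ℓ) (q : Fin k) →
              toℕ i * (k ∸ 1) + toℕ q < (k ∸ 1) * ℓ + 1
pathVertex< (suc d) ℓ i q = begin-strict
  toℕ i * d + toℕ q  ≤⟨ ℕ.+-monoʳ-≤ (toℕ i * d) (ℕ.≤-pred (toℕ<n q)) ⟩
  toℕ i * d + d      ≡⟨ ℕ.+-comm (toℕ i * d) d ⟩
  suc (toℕ i) * d    ≤⟨ ℕ.*-monoˡ-≤ d (toℕ<n i) ⟩
  ℓ * d              ≡⟨ ℕ.*-comm ℓ d ⟩
  d * ℓ              <⟨ ℕ.m<m+n (d * ℓ) (s≤s z≤n) ⟩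
  d * ℓ + 1          ∎
  where open ℕ.≤-Reasoning

pathVertex : ∀ k ℓ → Fin ℓ → Fin k ↣ Fin ((k ∸ 1) * ℓ + 1)
pathVertex k ℓ i = mk↣ {to = λ q → fromℕ< (pathVertex< k ℓ i q)} λ {p} {q} eq →
  toℕ-injective (ℕ.+-cancelˡ-≡ (toℕ i * (k ∸ 1)) (toℕ p) (toℕ q)
    (fromℕ<-injective _ _ (pathVertex< k ℓ i p) (pathVertex< k ℓ i q) eq))

pathEdge : ∀ k ℓ → Fin ℓ → KSubset k ((k ∸ 1) * ℓ + 1)
pathEdge k ℓ i = mapKSubset (pathVertex k ℓ i) (⊤ , ∣⊤∣≡n k)

loosePath : (k ℓ : ℕ) → Hypergraph k
loosePath k ℓ .order  = (k ∸ 1) * ℓ + 1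
loosePath k ℓ .Edge e = ∃[ i ] e ≡ pathEdge k ℓ i

-- The edges of the complete k-graph on n vertices are all the k-subsets.
Colouring : (k n r : ℕ) → Set
Colouring k n r = KSubset k n → Fin r

MonochromaticCopy : Hypergraph k → Colouring k n r → Set
MonochromaticCopy {n = n} {r = r} H χ =
  Σ[ φ ∈ (Fin (order H) ↣ Fin n) ] Σ[ c ∈ Fin r ]
    (∀ e → Edge H e → χ (mapKSubset φ e) ≡ c)

Arrows : (n : ℕ) → Hypergraph k → (r : ℕ) → Set
Arrows {k} n H r = (χ : Colouring k n r) → MonochromaticCopy H χ

-- R(H; r) = n; stated as a relation because the existence of the minimum
-- is Ramsey's theorem.
IsRamseyNumber : Hypergraph k → (r n : ℕ) → Set
IsRamseyNumber H r n = Arrows n H r × (∀ m → Arrows m H r → n ≤ m)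

{-# OPTIONS --safe #-}

-- Only a sparse family of edges is needed.  Place N = ℓ r of the
-- (k − 1) ℓ r vertices on a cycle and group the others into N blocks of k − 2.
-- To an arc of length d + 1 < N of the cycle belongs the edge made of its two
-- ends and the block d.  In a sequence of growing arcs whose consecutive
-- members share alternately their left and their right end (a zigzag), all the
-- ends and all the lengths are different, so that ℓ arcs give a loose path of
-- ℓ edges.  The blocks cause no further intersection, and there remains the
-- argument for convex geometric graphs: dropping, alternately for every left
-- and every right end, the longest arc of each colour costs at most r N arcs
-- per round, and (ℓ − 1) r N < N (N − 1).

module Submission where

open import Defs
open import Data.Bool.Base using (true; false; if_then_else_)
open import Data.Fin.Base using (Fin; zero; suc; toℕ; fromℕ; inject₁; inject≤; cast; combine; remQuot)
open import Data.Fin.Properties 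
  using (any?; all?; toℕ<n; toℕ-injective; toℕ-fromℕ; toℕ-fromℕ<; toℕ-inject₁; toℕ-inject≤;
         inject≤-injective; toℕ-cast; toℕ-combine; combine-injective; combine-remQuot;
         remQuot-combine; pigeonhole; <⇒≢)
  renaming (_≟_ to _≟ᶠ_)
open import Data.Fin.Relation.Unary.Top using (view; ‵fromℕ; ‵inject₁)
open import Data.Fin.Subset using (Subset; ∣_∣; _∈_; ⁅_⁆; _∪_; ⊤)
open import Data.Fin.Subset.Properties
  using (∈⊤; ⊆-antisym; x∈⁅x⁆; x∈⁅y⁆⇒x≡y; x∈p∪q⁺; x∈p∪q⁻; ∪-comm; ∪-assoc)
open import Data.Nat.Base using (ℕ; zero; suc; _+_; _*_; _∸_; _≤_; _<_; z≤n; s≤s)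
open import Data.Nat.DivMod
  using (_%_; _mod_; m%n<n; m<n⇒m%n≡m; [m+kn]%n≡m%n; %-distribˡ-+; m%n%n≡m%n)
open import Data.Nat.Induction using (<-rec)
import Data.Nat.Properties as ℕ
open import Data.Product.Base using (Σ-syntax; ∃-syntax; _×_; _,_; proj₁; proj₂; uncurry)
open import Data.Sum.Base using (_⊎_; inj₁; inj₂)
open import Data.Vec.Base using ([]; _∷_)
open import Function.Base using (_∘_)
open import Function.Bundles using (mk↣; module Injection)
open import Function.Definitions using (Injective)
open import Relation.Binary.Definitions using (tri<; tri≈; tri>)
open import Relation.Binary.PropositionalEquality
  using (_≡_; _≢_; _≗_; refl; sym; trans; cong; cong₂; subst; module ≡-Reasoning)
open import Relation.Nullary.Decidable.Core using (Dec; yes; no; map′; _×-dec_; _→-dec_)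
open import Relation.Nullary.Negation using (¬_; contradiction)
open import Relation.Unary using (Decidable)

private
  variable
    k m n r M : ℕ

-- Finite searches

-- Without function extensionality `f` is only pointwise equal to the function rebuilt from `f zero`
-- and `f ∘ suc`, so `P` has to respect `_≗_`.
∃-function? : ∀ m {P : (Fin m → Fin n) → Set} → (∀ {f g} → f ≗ g → P f → P g) →
              Decidable P → Dec (∃[ f ] P f)
∃-function? {n} zero    resp P? =
  map′ (nil ,_) (λ (f , p) → resp (λ ()) p) (P? nil)
  where
  nil : Fin 0 → Fin n
  nil ()
∃-function? {n} (suc m) {P} resp P? =
  map′ (λ (x , f , p) → cons x f , p)
       (λ (f , p) → f zero , f ∘ suc , resp (λ { zero → refl ; (suc i) → refl }) p)
       (any? λ x → ∃-function? m (λ f≗g → resp (λ { zero → refl ; (suc i) → f≗g i }))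
                                 (λ f → P? (cons x f)))
  where
  cons : Fin n → (Fin m → Fin n) → Fin (suc m) → Fin n
  cons x f zero    = x
  cons x f (suc i) = f i

-- Splitting by the first bit makes two functions on the subsets of n points out of one on the
-- subsets of n + 1 points; colourings are enumerated in this way.
∀-subsetFunction? : ∀ n {P : (Subset n → Fin r) → Set} → (∀ {f g} → f ≗ g → P f → P g) →
                    Decidable P → Dec (∀ f → P f)
∀-subsetFunction? zero    resp P? =
  map′ (λ p f → resp (λ { [] → refl }) (p (f []))) (λ p x → p (λ _ → x))
       (all? λ x → P? (λ _ → x))
∀-subsetFunction? {r} (suc n) {P} resp P? =
  map′ (λ p h → resp (λ { (true ∷ s) → refl ; (false ∷ s) → refl })
                     (p (h ∘ (true ∷_)) (h ∘ (false ∷_))))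
       (λ p f g → p (join f g))
       (∀-subsetFunction? n
         (λ f≗f′ p g → resp (λ { (true ∷ s) → f≗f′ s ; (false ∷ s) → refl }) (p g))
         (λ f → ∀-subsetFunction? n
           (λ g≗g′ → resp (λ { (true ∷ s) → refl ; (false ∷ s) → g≗g′ s }))
           (λ g → P? (join f g))))
  where
  join : (Subset n → Fin r) → (Subset n → Fin r) → Subset (suc n) → Fin r
  join f g (b ∷ s) = if b then f s else g s

least : {P : ℕ → Set} → Decidable P → ∀ n → P n →
        ∃[ m ] (P m × (∀ j → P j → m ≤ j)) × m ≤ n
least {P} P? = <-rec _ step
  where
  Least : ℕ → Set
  Least n = P n → ∃[ m ] (P m × (∀ j → P j → m ≤ j)) × m ≤ n

  step : ∀ n → (∀ {i} → i < n → Least i) → Least n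
  step n rec pn with ℕ.anyUpTo? P? n
  ... | yes (i , i<n , pi) = let m , least-m , m≤i = rec i<n pi in
                             m , least-m , ℕ.≤-trans m≤i (ℕ.<⇒≤ i<n)
  ... | no ∄i = n , (pn , λ j pj → ℕ.≮⇒≥ λ j<n → ∄i (j , j<n , pj)) , ℕ.≤-refl

first-failure : {P : ℕ → Set} → Decidable P → P 0 → ∀ m →
                P m ⊎ ∃[ i ] (P (toℕ {m} i) × ¬ P (suc (toℕ i)))
first-failure P? p zero    = inj₁ p
first-failure P? p (suc m) with P? 1
... | no ¬p₁ = inj₂ (zero , p , ¬p₁)
... | yes p₁ with first-failure (P? ∘ suc) p₁ m
...   | inj₁ pₘ       = inj₁ pₘ
...   | inj₂ (i , pᵢ) = inj₂ (suc i , pᵢ)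

-- Decidability of the arrow relation

KSubset-≡ : {s t : KSubset k n} → proj₁ s ≡ proj₁ t → s ≡ t
KSubset-≡ {s = s , p} {t = .s , q} refl = cong (s ,_) (ℕ.≡-irrelevant p q)

image-cong : {f g : Fin m → Fin n} → f ≗ g → ∀ s → image f s ≡ image g s
image-cong f≗g []          = refl
image-cong f≗g (true  ∷ s) = cong₂ (λ x t → ⁅ x ⁆ ∪ t) (f≗g zero) (image-cong (f≗g ∘ suc) s)
image-cong f≗g (false ∷ s) = image-cong (f≗g ∘ suc) s

-- `Edge` is an arbitrary predicate, so quantification over the edges need not be decidable; for a
-- loose path it runs over the edge numbers.
∀Edge? : (H : Hypergraph k) → Set₁
∀Edge? H = ∀ {P : KSubset _ (order H) → Set} → Decidable P → Dec (∀ e → Edge H e → P e)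

∀Edge-loosePath? : ∀ k ℓ → ∀Edge? (loosePath k ℓ)
∀Edge-loosePath? k ℓ P? =
  map′ (λ { p _ (i , refl) → p i }) (λ p i → p _ (i , refl)) (all? (P? ∘ pathEdge k ℓ))

injective? : (f : Fin m → Fin n) → Dec (Injective _≡_ _≡_ f)
injective? f = map′ (λ inj {x} {y} → inj x y) (λ inj x y → inj {x} {y})
  (all? λ x → all? λ y → (f x ≟ᶠ f y) →-dec (x ≟ᶠ y))

monochromaticCopy? : (H : Hypergraph k) → ∀Edge? H → (χ : Colouring k n r) →
                     Dec (MonochromaticCopy H χ)
monochromaticCopy? {k} {n} H edges? χ =
  map′ (λ (f , inj , mono) → mk↣ inj , mono)
       (λ (φ , mono) → Injection.to φ , (λ {x} {y} → Injection.injective φ {x} {y}) , mono)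
       (∃-function? (order H) resp dec)
  where
  Copy : (Fin (order H) → Fin n) → Set
  Copy f = Σ[ inj ∈ Injective _≡_ _≡_ f ] ∃[ c ]
    (∀ e → Edge H e → χ (mapKSubset (mk↣ {to = f} inj) e) ≡ c)

  resp : ∀ {f g} → f ≗ g → Copy f → Copy g
  resp f≗g (inj , c , mono) =
    (λ {x} {y} eq → inj (trans (f≗g x) (trans eq (sym (f≗g y))))) , c ,
    λ e e∈H → trans (cong χ (KSubset-≡ (sym (image-cong f≗g (proj₁ e))))) (mono e e∈H)

  dec : Decidable Copy
  dec f with injective? f
  ... | no ¬inj = no (¬inj ∘ proj₁)
  ... | yes inj = map′ (inj ,_)
    (λ (inj′ , c , mono) → c , λ e e∈H → trans (cong χ (KSubset-≡ refl)) (mono e e∈H))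
    (any? λ c → edges? λ e → χ (mapKSubset (mk↣ inj) e) ≟ᶠ c)

MonochromaticCopy-resp-≗ : (H : Hypergraph k) {χ χ′ : Colouring k n r} → χ ≗ χ′ →
                           MonochromaticCopy H χ → MonochromaticCopy H χ′
MonochromaticCopy-resp-≗ H χ≗χ′ (φ , c , mono) =
  φ , c , λ e e∈H → trans (sym (χ≗χ′ _)) (mono e e∈H)

-- A colouring of all subsets can be enumerated bit by bit, and it colours a set without a proof of
-- its size. Other sizes get the default colour `zero`.
extend : Colouring k n (suc r) → Subset n → Fin (suc r)
extend {k} χ s with ∣ s ∣ ℕ.≟ k
... | yes ∣s∣≡k = χ (s , ∣s∣≡k)
... | no  _     = zero

extend-KSubset : (χ : Colouring k n (suc r)) (s : KSubset k n) → extend χ (proj₁ s) ≡ χ s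
extend-KSubset {k} χ (s , ∣s∣≡k) with ∣ s ∣ ℕ.≟ k
... | yes _     = cong χ (KSubset-≡ refl)
... | no  ∣s∣≢k = contradiction ∣s∣≡k ∣s∣≢k

arrows? : (H : Hypergraph k) → ∀Edge? H → ∀ n r → Dec (Arrows n H (suc r))
arrows? H edges? n r = map′
  (λ p χ → MonochromaticCopy-resp-≗ H (extend-KSubset χ) (p (extend χ)))
  (λ p f → p (f ∘ proj₁))
  (∀-subsetFunction? n (λ f≗g → MonochromaticCopy-resp-≗ H (f≗g ∘ proj₁))
                       (λ f → monochromaticCopy? H edges? (f ∘ proj₁)))

-- Rotations of ℤ/N

-- Since c + c M = c (M + 1) is a multiple of the modulus, `c * M` acts as the negative of c.
%-+-cancelʳ : ∀ a b c → (a + c) % suc M ≡ (b + c) % suc M → a % suc M ≡ b % suc M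
%-+-cancelʳ {M} a b c eq = trans (sym (unwind a)) (trans step (unwind b))
  where
  unwind : ∀ a → (a + c + c * M) % suc M ≡ a % suc M
  unwind a = begin
    (a + c + c * M)   % suc M  ≡⟨ cong (_% suc M) (ℕ.+-assoc a c (c * M)) ⟩
    (a + (c + c * M)) % suc M  ≡⟨ cong (λ x → (a + x) % suc M) (ℕ.*-suc c M) ⟨
    (a + c * suc M)   % suc M  ≡⟨ [m+kn]%n≡m%n a c (suc M) ⟩
    a % suc M                  ∎
    where open ≡-Reasoning

  step : (a + c + c * M) % suc M ≡ (b + c + c * M) % suc M
  step = begin
    (a + c + c * M) % suc M                          ≡⟨ %-distribˡ-+ (a + c) (c * M) (suc M) ⟩
    ((a + c) % suc M + (c * M) % suc M) % suc M      ≡⟨ cong (λ x → (x + (c * M) % suc M) % suc M) eq ⟩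
    ((b + c) % suc M + (c * M) % suc M) % suc M      ≡⟨ %-distribˡ-+ (b + c) (c * M) (suc M) ⟨
    (b + c + c * M) % suc M                          ∎
    where open ≡-Reasoning

shift : Fin (suc M) → ℕ → Fin (suc M)
shift {M} x t = (toℕ x + t) mod suc M

toℕ-shift : ∀ (x : Fin (suc M)) t → toℕ (shift x t) ≡ (toℕ x + t) % suc M
toℕ-shift {M} x t = toℕ-fromℕ< (m%n<n (toℕ x + t) (suc M))

shift-% : ∀ (x y : Fin (suc M)) s t → shift x s ≡ shift y t →
          (toℕ x + s) % suc M ≡ (toℕ y + t) % suc M
shift-% x y s t eq = trans (sym (toℕ-shift x s)) (trans (cong toℕ eq) (toℕ-shift y t))

toℕ-% : (x : Fin (suc M)) → toℕ x % suc M ≡ toℕ x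
toℕ-% x = m<n⇒m%n≡m (toℕ<n x)

shift-zero : (x : Fin (suc M)) → shift x 0 ≡ x
shift-zero {M} x = toℕ-injective
  (trans (toℕ-shift x 0) (trans (cong (_% suc M) (ℕ.+-identityʳ (toℕ x))) (toℕ-% x)))

shift-+ : ∀ (x : Fin (suc M)) s t → shift (shift x s) t ≡ shift x (s + t)
shift-+ {M} x s t = toℕ-injective (begin
  toℕ (shift (shift x s) t)                    ≡⟨ toℕ-shift (shift x s) t ⟩
  (toℕ (shift x s) + t) % N                    ≡⟨ cong (λ y → (y + t) % N) (toℕ-shift x s) ⟩
  ((toℕ x + s) % N + t) % N                    ≡⟨ %-distribˡ-+ ((toℕ x + s) % N) t N ⟩
  ((toℕ x + s) % N % N + t % N) % N            ≡⟨ cong (λ y → (y + t % N) % N)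
                                                         (m%n%n≡m%n (toℕ x + s) N) ⟩
  ((toℕ x + s) % N + t % N) % N                ≡⟨ %-distribˡ-+ (toℕ x + s) t N ⟨
  (toℕ x + s + t) % N                          ≡⟨ cong (_% N) (ℕ.+-assoc (toℕ x) s t) ⟩
  (toℕ x + (s + t)) % N                        ≡⟨ toℕ-shift x (s + t) ⟨
  toℕ (shift x (s + t))                        ∎)
  where
  open ≡-Reasoning
  N = suc M

shift-cancelʳ : ∀ (x y : Fin (suc M)) t → shift x t ≡ shift y t → x ≡ y
shift-cancelʳ x y t eq = toℕ-injective (begin
  toℕ x        ≡⟨ toℕ-% x ⟨
  toℕ x % _    ≡⟨ %-+-cancelʳ (toℕ x) (toℕ y) t (shift-% x y t t eq) ⟩
  toℕ y % _    ≡⟨ toℕ-% y ⟩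
  toℕ y        ∎)
  where open ≡-Reasoning

shift-cancelˡ : ∀ (x : Fin (suc M)) {s t} → s ≤ M → t ≤ M → shift x s ≡ shift x t → s ≡ t
shift-cancelˡ {M} x {s} {t} s≤M t≤M eq = begin
  s            ≡⟨ m<n⇒m%n≡m (s≤s s≤M) ⟨
  s % suc M    ≡⟨ %-+-cancelʳ s t (toℕ x) swapped ⟩
  t % suc M    ≡⟨ m<n⇒m%n≡m (s≤s t≤M) ⟩
  t            ∎
  where
  open ≡-Reasoning
  swapped : (s + toℕ x) % suc M ≡ (t + toℕ x) % suc M
  swapped = begin
    (s + toℕ x) % suc M  ≡⟨ cong (_% suc M) (ℕ.+-comm s (toℕ x)) ⟩
    (toℕ x + s) % suc M  ≡⟨ shift-% x x s t eq ⟩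
    (toℕ x + t) % suc M  ≡⟨ cong (_% suc M) (ℕ.+-comm t (toℕ x)) ⟨
    (t + toℕ x) % suc M  ∎

-- Arcs of the cycle

-- (x , d) is the arc from x to x + d + 1 in the cycle ℤ/(M + 1).
Arc : ℕ → Set
Arc M = Fin (suc M) × Fin M

len : Arc M → ℕ
len (x , d) = toℕ d

-- Even indices mean the left end, odd ones the right end; with this period the step number of a
-- zigzag can itself name the shared end.
end : ℕ → Arc M → Fin (suc M)
end 0             (x , d) = x
end 1             (x , d) = shift x (suc (toℕ d))
end (suc (suc i)) a       = end i a

Inside : Arc M → Fin (suc M) → Set
Inside a z = ∃[ t ] t < len a × z ≡ shift (proj₁ a) (suc t)

len<M : (a : Arc M) → len a < M
len<M (x , d) = toℕ<n d

end-len-injective : ∀ i (a b : Arc M) → end i a ≡ end i b → len a ≡ len b → a ≡ b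
end-len-injective 0 (x , d) (y , e) x≡y len≡ = cong₂ _,_ x≡y (toℕ-injective len≡)
end-len-injective 1 (x , d) (y , e) eq  len≡ with refl ← toℕ-injective len≡ =
  cong (_, d) (shift-cancelʳ x y (suc (toℕ d)) eq)
end-len-injective (suc (suc i)) a b = end-len-injective i a b

end≢end : ∀ i (a : Arc M) → end i a ≢ end (suc i) a
end≢end 0 (x , d) eq with () ←
  shift-cancelˡ x z≤n (toℕ<n d) (trans (shift-zero x) eq)
end≢end 1             a eq = end≢end 0 a (sym eq)
end≢end (suc (suc i)) a    = end≢end i a

-- No arc goes round the whole cycle: all shifts involved are at most M and so lead to different
-- points.
end∉Inside : ∀ i (a : Arc M) → ¬ Inside a (end i a)
end∉Inside 0 (x , d) (t , t<d , eq) with () ←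
  shift-cancelˡ x z≤n (ℕ.<-trans t<d (toℕ<n d)) (trans (shift-zero x) eq)
end∉Inside 1 (x , d) (t , t<d , eq) =
  ℕ.<⇒≢ t<d (sym (ℕ.suc-injective (shift-cancelˡ x (toℕ<n d) (ℕ.<-trans t<d (toℕ<n d)) eq)))
end∉Inside (suc (suc i)) a = end∉Inside i a

sameRightEnd : (a b : Arc M) → end 1 a ≡ end 1 b → len a < len b →
               proj₁ a ≡ shift (proj₁ b) (len b ∸ len a)
sameRightEnd (x , d) (y , e) eq d<e = shift-cancelʳ x _ (suc (toℕ d)) (begin
  shift x (suc (toℕ d))                          ≡⟨ eq ⟩
  shift y (suc (toℕ e))                          ≡⟨ cong (shift y ∘ suc) (ℕ.m∸n+n≡m (ℕ.<⇒≤ d<e)) ⟨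
  shift y (suc (toℕ e ∸ toℕ d + toℕ d))          ≡⟨ cong (shift y) (ℕ.+-suc (toℕ e ∸ toℕ d) (toℕ d)) ⟨
  shift y (toℕ e ∸ toℕ d + suc (toℕ d))          ≡⟨ shift-+ y (toℕ e ∸ toℕ d) (suc (toℕ d)) ⟨
  shift (shift y (toℕ e ∸ toℕ d)) (suc (toℕ d))  ∎)
  where open ≡-Reasoning

-- Of two arcs with a common end the shorter is an initial or final piece of the longer. This puts
-- each new vertex of a zigzag inside the preceding arc.
otherEnd-Inside : ∀ i (a b : Arc M) → end i a ≡ end i b → len a < len b →
                  Inside b (end (suc i) a)
otherEnd-Inside 0 (x , d) (.x , e) refl d<e = toℕ d , d<e , refl
otherEnd-Inside 1 a b eq a<b with len b ∸ len a in gap | sameRightEnd a b eq a<b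
... | zero  | _ = contradiction (ℕ.m∸n≡0⇒m≤n gap) (ℕ.<⇒≱ a<b)
-- `Inside` counts its points from 1, so the distance `suc g` of the left ends has the witness `g`.
... | suc g | x≡ = g , subst (_≤ len b) gap (ℕ.m∸n≤m (len b) (len a)) , x≡
otherEnd-Inside (suc (suc i)) a b = otherEnd-Inside i a b

Inside-mono : ∀ i (a b : Arc M) → end i a ≡ end i b → len a < len b →
              ∀ {z} → Inside a z → Inside b z
Inside-mono 0 (x , d) (.x , e) refl d<e (t , t<d , eq) = t , ℕ.<-trans t<d d<e , eq
Inside-mono 1 a b eq a<b {z} (t , t<a , z≡) = len b ∸ len a + t , bound , (begin
  z                                                ≡⟨ z≡ ⟩
  shift (proj₁ a) (suc t)                          ≡⟨ cong (λ x → shift x (suc t)) (sameRightEnd a b eq a<b) ⟩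
  shift (shift (proj₁ b) (len b ∸ len a)) (suc t)  ≡⟨ shift-+ (proj₁ b) (len b ∸ len a) (suc t) ⟩
  shift (proj₁ b) (len b ∸ len a + suc t)          ≡⟨ cong (shift (proj₁ b)) (ℕ.+-suc (len b ∸ len a) t) ⟩
  shift (proj₁ b) (suc (len b ∸ len a + t))        ∎)
  where
  open ≡-Reasoning
  bound : len b ∸ len a + t < len b
  bound = subst (len b ∸ len a + t <_) (ℕ.m∸n+n≡m (ℕ.<⇒≤ a<b)) (ℕ.+-monoʳ-< (len b ∸ len a) t<a)
Inside-mono (suc (suc i)) a b = Inside-mono i a b

-- Monochromatic zigzags

module Zigzags {M r : ℕ} (colour : Arc M → Fin r) where

  -- Zigzags are built from the longest arc downwards: `a` is the arc added last and the shortest.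
  -- Its end i is still free and is the one that the next step shares, hence the alternation.
  data Zigzag : ℕ → Arc M → Set where
    single : ∀ {a} → Zigzag 0 a
    grow   : ∀ {i a b} → Zigzag i b → colour b ≡ colour a → end i b ≡ end i a →
             len a < len b → Zigzag (suc i) a

  ∃Arc? : {P : Arc M → Set} → Decidable P → Dec (∃[ a ] P a)
  ∃Arc? P? = map′ (λ (x , d , p) → (x , d) , p) (λ ((x , d) , p) → x , d , p)
                  (any? λ x → any? λ d → P? (x , d))

  zigzag? : ∀ i a → Dec (Zigzag i a)
  zigzag? zero    a = yes single
  zigzag? (suc i) a =
    map′ (λ (b , z , c , e , l) → grow z c e l) (λ { (grow z c e l) → _ , z , c , e , l })
         (∃Arc? λ b → zigzag? i b ×-dec (colour b ≟ᶠ colour a) ×-dec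
                      (end i b ≟ᶠ end i a) ×-dec (len a ℕ.<? len b))

  -- The rank i of an arc is the first one with no zigzag of i + 1 steps
  -- ending in it.  Of two arcs of equal colour and rank i that share the
  -- end i, the shorter one would extend the zigzag of the longer one, so
  -- colour, rank and that end determine the arc.
  ∃Zigzag : ∀ m → r * m < M → ∃[ a ] Zigzag m a
  ∃Zigzag m rm<M with ∃Arc? (zigzag? m)
  ... | yes found = found
  ... | no  ∄     =
    let i , j , i<j , eq = pigeonhole fewLabels (label ∘ arc)
    in  contradiction (arc-injective i j (label-injective (arc i) (arc j) eq)) (<⇒≢ i<j)
    where
    rank : ∀ a → ∃[ i ] (Zigzag (toℕ {m} i) a × ¬ Zigzag (suc (toℕ i)) a)
    rank a with first-failure (λ i → zigzag? i a) single m
    ... | inj₁ z = contradiction (a , z) ∄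
    ... | inj₂ i = i

    label : Arc M → Fin (r * m * suc M)
    label a = combine (combine (colour a) (proj₁ (rank a))) (end (toℕ (proj₁ (rank a))) a)

    label-injective : ∀ a b → label a ≡ label b → a ≡ b
    label-injective a b eq with rank a | rank b
    ... | i , zᵃ , ¬zᵃ | j , zᵇ , ¬zᵇ
      with ci≡cj , end≡ ← 
        combine-injective (combine (colour a) i) (end (toℕ i) a)
                          (combine (colour b) j) (end (toℕ j) b) eq
      with c≡ , refl ← combine-injective (colour a) i (colour b) j ci≡cj
      with ℕ.<-cmp (len a) (len b)
    ... | tri< a<b _ _ = contradiction (grow zᵇ (sym c≡) (sym end≡) a<b) ¬zᵃ
    ... | tri≈ _ a≡b _ = end-len-injective (toℕ i) a b end≡ a≡b
    ... | tri> _ _ b<a = contradiction (grow zᵃ c≡ end≡ b<a) ¬zᵇ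

    arc : Fin (suc M * M) → Arc M
    arc = remQuot {suc M} M

    -- There are (M + 1) M arcs, so r m < M leaves fewer labels than arcs.
    fewLabels : r * m * suc M < suc M * M
    fewLabels = subst (_< suc M * M) (ℕ.*-comm (suc M) (r * m)) (ℕ.*-monoʳ-< (suc M) rm<M)

    arc-injective : ∀ i j → arc i ≡ arc j → i ≡ j
    arc-injective i j eq = begin
      i                        ≡⟨ combine-remQuot {suc M} M i ⟨
      uncurry combine (arc i)  ≡⟨ cong (uncurry combine) eq ⟩
      uncurry combine (arc j)  ≡⟨ combine-remQuot {suc M} M j ⟩
      j                        ∎
      where open ≡-Reasoning

  -- Vertices and lengths along a zigzag

  private
    variable
      i : ℕ
      a : Arc M

  arcs : Zigzag i a → Fin (suc i) → Arc M
  arcs {a = a} z                zero    = a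
  arcs         (grow z _ _ _)   (suc j) = arcs z j

  -- The enumeration starts at the free end of the shortest arc. Shared ends occur once, whence i +
  -- 2 points for i + 1 arcs.
  vertices : Zigzag i a → Fin (2 + i) → Fin (suc M)
  vertices {i} {a} z              zero    = end i a
  vertices {a = a} single         (suc _) = end 1 a
  vertices         (grow z _ _ _) (suc j) = vertices z j

  -- The last value is a dummy larger than all lengths.
  lengths : Zigzag i a → Fin (2 + i) → Fin (suc M)
  lengths {a = a} z              zero    = inject₁ (proj₂ a)
  lengths         single         (suc _) = fromℕ M
  lengths         (grow z _ _ _) (suc j) = lengths z j

  arcs-colour : (z : Zigzag i a) → ∀ j → colour (arcs z j) ≡ colour a
  arcs-colour z              zero    = refl
  arcs-colour (grow z c _ _) (suc j) = trans (arcs-colour z j) c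

  arcs-lengths : (z : Zigzag i a) → ∀ j → lengths z (inject₁ j) ≡ inject₁ (proj₂ (arcs z j))
  arcs-lengths z              zero    = refl
  arcs-lengths (grow z _ _ _) (suc j) = arcs-lengths z j

  -- The witness p is the number of steps of the part of the zigzag that ends in the given arc; its
  -- parity tells which end of the arc comes first.
  arcs-vertices : (z : Zigzag i a) → ∀ j → ∃[ p ]
    vertices z (inject₁ j) ≡ end p (arcs z j) × vertices z (suc j) ≡ end (suc p) (arcs z j)
  arcs-vertices single                          zero    = 0 , refl , refl
  arcs-vertices (grow     single         _ e _) zero    = 1 , refl , e
  arcs-vertices (grow {i} (grow _ _ _ _) _ e _) zero    = suc i , refl , e
  arcs-vertices (grow z _ _ _)                  (suc j) = arcs-vertices z j

  lengths-head : (z : Zigzag i a) → ∀ j → len a < toℕ (lengths z (suc j))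
  lengths-head {a = a} single zero    = subst (len a <_) (sym (toℕ-fromℕ M)) (len<M a)
  lengths-head {a = a} (grow {b = b} z _ _ a<b) zero =
    subst (len a <_) (sym (toℕ-inject₁ (proj₂ b))) a<b
  lengths-head (grow z _ _ a<b) (suc j) = ℕ.<-trans a<b (lengths-head z j)

  lengths-head≢ : (z : Zigzag i a) → ∀ j → lengths z zero ≢ lengths z (suc j)
  lengths-head≢ {a = a} z j eq =
    ℕ.<⇒≢ (lengths-head z j) (trans (sym (toℕ-inject₁ (proj₂ a))) (cong toℕ eq))

  -- The arcs are nested, so a point inside the shortest is inside all of them, also inside the arc
  -- of which it would be an end.
  vertices∉Inside : (z : Zigzag i a) → ∀ j → ¬ Inside a (vertices z j)
  vertices∉Inside {i} {a} z zero = end∉Inside i a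
  vertices∉Inside {a = a} single (suc _) = end∉Inside 1 a
  vertices∉Inside {a = a} (grow {i} {b = b} z _ e a<b) (suc j) =
    vertices∉Inside z j ∘ Inside-mono i a b (sym e) a<b

  -- The new vertex lies strictly inside the preceding arc, where by `vertices∉Inside` no earlier
  -- vertex lies.
  vertices-head≢ : (z : Zigzag i a) → ∀ j → vertices z zero ≢ vertices z (suc j)
  vertices-head≢ {a = a} single j = end≢end 0 a
  vertices-head≢ {a = a} (grow {i} {b = b} z _ e a<b) j eq =
    vertices∉Inside z j (subst (Inside b) eq (otherEnd-Inside i a b (sym e) a<b))

  lengths-injective : (z : Zigzag i a) → Injective _≡_ _≡_ (lengths z)
  lengths-injective z              {zero}  {zero}  eq = refl
  lengths-injective z              {zero}  {suc y} eq = contradiction eq (lengths-head≢ z y)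
  lengths-injective z              {suc x} {zero}  eq = contradiction (sym eq) (lengths-head≢ z x)
  lengths-injective single         {suc zero} {suc zero} eq = refl
  lengths-injective (grow z _ _ _) {suc x} {suc y} eq = cong suc (lengths-injective z eq)

  vertices-injective : (z : Zigzag i a) → Injective _≡_ _≡_ (vertices z)
  vertices-injective z              {zero}  {zero}  eq = refl
  vertices-injective z              {zero}  {suc y} eq = contradiction eq (vertices-head≢ z y)
  vertices-injective z              {suc x} {zero}  eq = contradiction (sym eq) (vertices-head≢ z x)
  vertices-injective single         {suc zero} {suc zero} eq = refl
  vertices-injective (grow z _ _ _) {suc x} {suc y} eq = cong suc (vertices-injective z eq)

-- Embedding loose paths

edgeSet : (Fin M → Fin (suc m) → Fin n) → (a b c : Fin M) → Subset n
edgeSet node a b c =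
  ⁅ node a zero ⁆ ∪ (⁅ node b zero ⁆ ∪ image (λ q → node c (suc q)) ⊤)

edgeSet-comm : ∀ (node : Fin M → Fin (suc m) → Fin n) a b c →
               edgeSet node a b c ≡ edgeSet node b a c
edgeSet-comm node a b c = begin
  A ∪ (B ∪ C)  ≡⟨ ∪-assoc A B C ⟨
  (A ∪ B) ∪ C  ≡⟨ cong (_∪ C) (∪-comm A B) ⟩
  (B ∪ A) ∪ C  ≡⟨ ∪-assoc B A C ⟩
  B ∪ (A ∪ C)  ∎
  where
  open ≡-Reasoning
  A = ⁅ node a zero ⁆
  B = ⁅ node b zero ⁆
  C = image (λ q → node c (suc q)) ⊤

-- A zigzag runs through its arcs in alternating directions, while `arcEdge` takes the left end
-- first; for odd i the two points change places in the union.
edgeSet-end : ∀ (node : Fin (suc M) → Fin (suc m) → Fin n) i (a : Arc M) c →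
              edgeSet node (end i a) (end (suc i) a) c ≡ edgeSet node (end 0 a) (end 1 a) c
edgeSet-end node 0             a c = refl
edgeSet-end node 1             a c = edgeSet-comm node (end 1 a) (end 0 a) c
edgeSet-end node (suc (suc i)) a c = edgeSet-end node i a c

-- Think of node x zero as the x-th point of a cycle and of the vertices
-- node c (suc q) as the c-th block: the arc (x , d) stands for its two
-- ends together with the block d.
module Embedding (node : Fin (suc M) → Fin (suc k) → Fin n)
                 (node-injective : ∀ {a b p q} → node a p ≡ node b q → a ≡ b × p ≡ q)
                 (χ : Colouring (2 + k) n (suc r)) where

  private
    K = suc k

  arcEdge : Arc M → Subset n
  arcEdge a = edgeSet node (end 0 a) (end 1 a) (inject₁ (proj₂ a))

  -- With `extend` the size of `arcEdge a` need not be computed: `mono` recognises the set as the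
  -- image of a path edge.
  arcColour : Arc M → Fin (suc r)
  arcColour = extend χ ∘ arcEdge

  open Zigzags arcColour

  -- The path is written in rows of K entries, row i being the i-th vertex of the zigzag followed by
  -- the block of the i-th length. An edge is a row together with the first entry of the next.
  zigzag⇒copy : ∀ {m a} → Zigzag m a → MonochromaticCopy (loosePath (2 + k) (suc m)) χ
  zigzag⇒copy {m} {a} z = mk↣ embed-injective , arcColour a , λ { e (i , refl) → mono i }
    where
    place : Fin (2 + m) → Fin K → Fin n
    place i zero    = node (vertices z i) zero
    place i (suc q) = node (lengths z i) (suc q)

    place-injective : (s t : Fin (2 + m) × Fin K) → uncurry place s ≡ uncurry place t → s ≡ t
    place-injective (i , zero) (j , zero) eq =
      cong (_, zero) (vertices-injective z (node-injective eq .proj₁))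
    place-injective (i , suc p) (j , suc q) eq =
      cong₂ _,_ (lengths-injective z (node-injective eq .proj₁)) (node-injective eq .proj₂)
    -- The second coordinate separates the points of the cycle from the blocks.
    place-injective (i , zero) (j , suc q) eq with () ← node-injective eq .proj₂
    place-injective (i , suc p) (j , zero) eq with () ← node-injective eq .proj₂

    order≤ : K * suc m + 1 ≤ (2 + m) * K
    order≤ = begin
      K * suc m + 1      ≡⟨ ℕ.+-comm (K * suc m) 1 ⟩
      1 + K * suc m      ≡⟨ cong suc (ℕ.*-comm K (suc m)) ⟩
      1 + suc m * K      ≤⟨ ℕ.+-monoˡ-≤ (suc m * K) (s≤s z≤n) ⟩
      K + suc m * K      ∎
      where open ℕ.≤-Reasoning

    embed : Fin (K * suc m + 1) → Fin n
    embed t = uncurry place (remQuot {2 + m} K (inject≤ t order≤))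

    embed-injective : Injective _≡_ _≡_ embed
    embed-injective {s} {t} eq = inject≤-injective order≤ order≤ s t (begin
      inject≤ s order≤              ≡⟨ combine-remQuot {2 + m} K (inject≤ s order≤) ⟨
      uncurry combine (position s)  ≡⟨ cong (uncurry combine)
                                            (place-injective (position s) (position t) eq) ⟩
      uncurry combine (position t)  ≡⟨ combine-remQuot {2 + m} K (inject≤ t order≤) ⟩
      inject≤ t order≤              ∎)
      where
      open ≡-Reasoning
      position : Fin (K * suc m + 1) → Fin (2 + m) × Fin K
      position t = remQuot {2 + m} K (inject≤ t order≤)

    embed-place : ∀ t i q → toℕ t ≡ toℕ i * K + toℕ q → embed t ≡ place i q
    embed-place t i q eq = begin
      embed t                                          ≡⟨ cong (uncurry place ∘ remQuot {2 + m} K) at ⟩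
      uncurry place (remQuot {2 + m} K (combine i q))  ≡⟨ cong (uncurry place) (remQuot-combine i q) ⟩
      place i q                                        ∎
      where
      open ≡-Reasoning
      at : inject≤ t order≤ ≡ combine i q
      at = toℕ-injective (begin
        toℕ (inject≤ t order≤)  ≡⟨ toℕ-inject≤ t order≤ ⟩
        toℕ t                   ≡⟨ eq ⟩
        toℕ i * K + toℕ q       ≡⟨ cong (_+ toℕ q) (ℕ.*-comm (toℕ i) K) ⟩
        K * toℕ i + toℕ q       ≡⟨ toℕ-combine i q ⟨
        toℕ (combine i q)       ∎)

    vertex : Fin (suc m) → Fin (2 + k) → Fin n
    vertex i q = embed (Injection.to (pathVertex (2 + k) (suc m) i) q)

    vertex-place : ∀ i q j p → toℕ i * K + toℕ q ≡ toℕ j * K + toℕ p → vertex i q ≡ place j p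
    vertex-place i q j p eq =
      embed-place _ j p (trans (toℕ-fromℕ< (pathVertex< (2 + k) (suc m) i q)) eq)

    vertex-inject₁ : ∀ i q → vertex i (inject₁ q) ≡ place (inject₁ i) q
    vertex-inject₁ i q = vertex-place i (inject₁ q) (inject₁ i) q
      (sym (cong₂ (λ x y → x * K + y) (toℕ-inject₁ i) (sym (toℕ-inject₁ q))))

    -- The last vertex of an edge has the number i K + K = (i + 1) K + 0 and so opens the next row.
    vertex-last : ∀ i → vertex i (fromℕ K) ≡ place (suc i) zero
    vertex-last i = vertex-place i (fromℕ K) (suc i) zero (begin
      toℕ i * K + toℕ (fromℕ K)  ≡⟨ cong (toℕ i * K +_) (toℕ-fromℕ K) ⟩
      toℕ i * K + K              ≡⟨ ℕ.+-comm (toℕ i * K) K ⟩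
      suc (toℕ i) * K            ≡⟨ ℕ.+-identityʳ _ ⟨
      suc (toℕ i) * K + 0        ∎)
      where open ≡-Reasoning

    edge : Fin (suc m) → KSubset (2 + k) n
    edge i = mapKSubset (mk↣ embed-injective) (pathEdge (2 + k) (suc m) i)

    stepSet : Fin (suc m) → Subset n
    stepSet i = edgeSet node (vertices z (inject₁ i)) (vertices z (suc i)) (lengths z (inject₁ i))

    vertex∈edge : ∀ i q → vertex i q ∈ proj₁ (edge i)
    vertex∈edge i q = ∈-image⁺ embed (∈-image⁺ (Injection.to (pathVertex (2 + k) (suc m) i)) ∈⊤)

    vertex∈stepSet : ∀ i q → vertex i q ∈ stepSet i
    vertex∈stepSet i q with view q
    ... | ‵fromℕ = subst (_∈ stepSet i) (sym (vertex-last i))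
      (x∈p∪q⁺ (inj₂ (x∈p∪q⁺ (inj₁ (x∈⁅x⁆ _)))))
    ... | ‵inject₁ zero = subst (_∈ stepSet i) (sym (vertex-inject₁ i zero))
      (x∈p∪q⁺ (inj₁ (x∈⁅x⁆ _)))
    ... | ‵inject₁ (suc q) = subst (_∈ stepSet i) (sym (vertex-inject₁ i (suc q)))
      (x∈p∪q⁺ (inj₂ (x∈p∪q⁺ (inj₂ (∈-image⁺ (λ q → node (lengths z (inject₁ i)) (suc q)) ∈⊤)))))

    edge⊆stepSet : ∀ i {y} → y ∈ proj₁ (edge i) → y ∈ stepSet i
    edge⊆stepSet i y∈ with ∈-image⁻ embed (proj₁ (pathEdge (2 + k) (suc m) i)) y∈
    ... | t , t∈ , refl with ∈-image⁻ (Injection.to (pathVertex (2 + k) (suc m) i)) ⊤ t∈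
    ...   | q , _ , refl = vertex∈stepSet i q

    stepSet⊆edge : ∀ i {y} → y ∈ stepSet i → y ∈ proj₁ (edge i)
    stepSet⊆edge i y∈ with x∈p∪q⁻ ⁅ place (inject₁ i) zero ⁆ _ y∈
    ... | inj₁ y∈ with refl ← x∈⁅y⁆⇒x≡y _ y∈ =
      subst (_∈ proj₁ (edge i)) (vertex-inject₁ i zero) (vertex∈edge i zero)
    ... | inj₂ y∈ with x∈p∪q⁻ ⁅ place (suc i) zero ⁆ _ y∈
    ...   | inj₁ y∈ with refl ← x∈⁅y⁆⇒x≡y _ y∈ =
      subst (_∈ proj₁ (edge i)) (vertex-last i) (vertex∈edge i (fromℕ K))
    ...   | inj₂ y∈ with q , _ , refl ← ∈-image⁻ (λ q → place (inject₁ i) (suc q)) ⊤ y∈ =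
      subst (_∈ proj₁ (edge i)) (vertex-inject₁ i (suc q)) (vertex∈edge i (inject₁ (suc q)))

    stepSet≡arcEdge : ∀ i → stepSet i ≡ arcEdge (arcs z i)
    stepSet≡arcEdge i with p , start , stop ← arcs-vertices z i = begin
      stepSet i                          ≡⟨ cong₂ (λ x y → edgeSet node x y c) start stop ⟩
      span c                             ≡⟨ cong span (arcs-lengths z i) ⟩
      span (inject₁ (proj₂ b))           ≡⟨ edgeSet-end node p b _ ⟩
      arcEdge b                          ∎
      where
      open ≡-Reasoning
      b = arcs z i
      c = lengths z (inject₁ i)
      span = edgeSet node (end p b) (end (suc p) b)

    mono : ∀ i → χ (edge i) ≡ arcColour a
    mono i = begin
      χ (edge i)                    ≡⟨ extend-KSubset χ (edge i) ⟨
      extend χ (proj₁ (edge i))     ≡⟨ cong (extend χ) (⊆-antisym (edge⊆stepSet i) (stepSet⊆edge i)) ⟩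
      extend χ (stepSet i)          ≡⟨ cong (extend χ) (stepSet≡arcEdge i) ⟩
      arcColour (arcs z i)          ≡⟨ arcs-colour z i ⟩
      arcColour a                   ∎
      where open ≡-Reasoning

-- The upper bound and the minimum

loosePath-arrows : ∀ k m r → Arrows (suc k * suc m * (2 + r)) (loosePath (2 + k) (suc m)) (2 + r)
loosePath-arrows k m r χ = zigzag⇒copy (∃Zigzag m few .proj₂)
  where
  blocks : suc m * (2 + r) * suc k ≡ suc k * suc m * (2 + r)
  blocks = trans (ℕ.*-comm (suc m * (2 + r)) (suc k)) (sym (ℕ.*-assoc (suc k) (suc m) (2 + r)))

  node : Fin (suc m * (2 + r)) → Fin (suc k) → Fin (suc k * suc m * (2 + r))
  node a q = cast blocks (combine a q)

  node-injective : ∀ {a b p q} → node a p ≡ node b q → a ≡ b × p ≡ q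
  node-injective {a} {b} {p} {q} eq = combine-injective a p b q (toℕ-injective (begin
    toℕ (combine a p)  ≡⟨ toℕ-cast blocks (combine a p) ⟨
    toℕ (node a p)     ≡⟨ cong toℕ eq ⟩
    toℕ (node b q)     ≡⟨ toℕ-cast blocks (combine b q) ⟩
    toℕ (combine b q)  ∎))
    where open ≡-Reasoning

  open Embedding node node-injective χ
  open Zigzags arcColour

  -- The cycle has (m + 1)(r + 2) points, so M = m (r + 2) + (r + 1) exceeds the product by r + 1.
  -- The m steps obtained give m + 1 arcs, one for each edge.
  few : (2 + r) * m < suc r + m * (2 + r)
  few = subst (_< suc r + m * (2 + r)) (ℕ.*-comm m (2 + r)) (ℕ.m<n+m (m * (2 + r)) (s≤s z≤n))

theorem1 : (k ℓ r : ℕ) → 2 ≤ k → 3 ≤ ℓ → 2 ≤ r →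
    ∃[ R ] (IsRamseyNumber (loosePath k ℓ) r R × R ≤ (k ∸ 1) * ℓ * r)
theorem1 (suc (suc k)) (suc m) (suc (suc r)) (s≤s (s≤s _)) _ (s≤s (s≤s _)) =
  -- The search for the minimum starts from a number known to arrow, and `least` also returns the
  -- comparison with it.
  least (λ n → arrows? (loosePath (2 + k) (suc m)) (∀Edge-loosePath? (2 + k) (suc m)) n (suc r))
        (suc k * suc m * (2 + r)) (loosePath-arrows k m r)
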